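{- If a graph $G$ has linear arboricity $2$, then $G$ is a unit rectangle visibility graph.
   Context: Graphs are finite and simple. The linear arboricity of a graph $G$ is the minimum number of linear forests (forests in which every component is a path) whose union is $G$. A graph $G$ is a unit rectangle visibility graph (URVG) if its vertices $v$ can be represented by closed unit squares $S_v$ in the plane with sides parallel to the coordinate axes and with pairwise disjoint interiors (squares may touch along their boundaries), in such a way that two distinct vertices $v,w$ are adjacent if and only if there is an unobstructed non-degenerate (positive width) horizontal or vertical band of visibility joining $S_v$ and $S_w$. Here a horizontal band of visibility joining $S_v$ and $S_w$ is given by an open interval $I$ of positive length such that for every $y_0\in I$ the line $y=y_0$ meets the interiors of both $S_v$ and $S_w$, and the part of this line between $S_v$ and $S_w$ (possibly a single point if the squares touch) meets the interior of no other square of the representation; vertical bands are defined analogously with the roles of $x$ and $y$ exchanged. -}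

module Defs where

open import Data.Fin using (Fin; zero; suc; toℕ; fromℕ; inject₁)
open import Data.Nat as ℕ using (ℕ; suc)
open import Data.Nat.Properties using (1+n≢n)
open import Data.Product using (Σ-syntax; ∃; ∃-syntax; _×_; _,_)
open import Data.Rational using (ℚ; 1ℚ; _+_; _-_; -_; _<_)
open import Data.Rational.Properties
  using (+-assoc; +-inverseˡ; +-inverseʳ; +-identityʳ; +-monoˡ-<)
open import Data.Sum using (_⊎_; inj₁; inj₂; swap; [_,_]′)
open import Function using (_∘_; _⇔_; mk⇔; Equivalence)
open import Function.Definitions using (Injective)
open import Level using (0ℓ)
open import Relation.Binary using (Rel; Decidable; Symmetric)
open import Relation.Binary.Construct.Closure.ReflexiveTransitive using (Star)
open import Relation.Binary.PropositionalEquality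
  using (_≡_; _≢_; refl; sym; trans; cong; subst)
open import Relation.Nullary using (¬_)
open import Relation.Nullary.Decidable using (_⊎-dec_)

------------------------------------------------------------------------
-- Graphs

record Graph (n : ℕ) : Set₁ where
  field
    Adj    : Rel (Fin n) 0ℓ
    adj?   : Decidable Adj
    symm   : Symmetric Adj
    irrefl : ∀ {v} → ¬ Adj v v

open Graph public

Connected : ∀ {n} → Graph n → Rel (Fin n) 0ℓ
Connected G = Star (Adj G)

Consecutive : ∀ {k} → Rel (Fin k) 0ℓ
Consecutive i j = toℕ j ≡ suc (toℕ i) ⊎ toℕ i ≡ suc (toℕ j)

pathGraph : ∀ k → Graph k
pathGraph k = record
  { Adj    = Consecutive
  ; adj?   = λ i j → (toℕ j ℕ.≟ suc (toℕ i)) ⊎-dec (toℕ i ℕ.≟ suc (toℕ j))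
  ; symm   = swap
  ; irrefl = [ 1+n≢n ∘ sym , 1+n≢n ∘ sym ]′
  }

-- A cycle with m + 3 vertices.
record Cycle {n} (G : Graph n) : Set where
  field
    m         : ℕ
    vertex    : Fin (3 ℕ.+ m) → Fin n
    injective : Injective _≡_ _≡_ vertex
    step      : ∀ (i : Fin (2 ℕ.+ m)) → Adj G (vertex (inject₁ i)) (vertex (suc i))
    close     : Adj G (vertex (fromℕ (2 ℕ.+ m))) (vertex zero)

IsForest : ∀ {n} → Graph n → Set
IsForest G = ¬ Cycle G

-- The connected component of v is isomorphic to a path graph.
record ComponentIsPath {n} (G : Graph n) (v : Fin n) : Set where
  field
    k         : ℕ
    vertex    : Fin k → Fin n
    injective : Injective _≡_ _≡_ vertex
    range     : ∀ w → Connected G v w ⇔ (∃[ i ] vertex i ≡ w)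
    adjacent  : ∀ i j → Adj (pathGraph k) i j ⇔ Adj G (vertex i) (vertex j)

IsLinearForest : ∀ {n} → Graph n → Set
IsLinearForest G = IsForest G × (∀ v → ComponentIsPath G v)

-- All forests are taken spanning: isolated vertices are one-vertex paths, so
-- enlarging the vertex set of a linear forest keeps it a linear forest.
UnionOfLinearForests : ∀ {n} → Graph n → ℕ → Set₁
UnionOfLinearForests {n} G k =
  Σ[ F ∈ (Fin k → Graph n) ]
    (∀ i → IsLinearForest (F i)) ×
    (∀ v w → Adj G v w ⇔ (∃[ i ] Adj (F i) v w))

HasLinearArboricity : ∀ {n} → Graph n → ℕ → Set₁
HasLinearArboricity G k =
  UnionOfLinearForests G k × (∀ j → UnionOfLinearForests G j → k ℕ.≤ j)

------------------------------------------------------------------------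
-- Real numbers, as two-sided Dedekind cuts of ℚ

record ℝ : Set₁ where
  field
    L U         : ℚ → Set
    L-inhabited : ∃ L
    U-inhabited : ∃ U
    L-rounded   : ∀ q → L q ⇔ (∃[ r ] q < r × L r)
    U-rounded   : ∀ q → U q ⇔ (∃[ r ] r < q × U r)
    disjoint    : ∀ q → ¬ (L q × U q)
    located     : ∀ q r → q < r → L q ⊎ U r

open ℝ public

infix 4 _<ℝ_ _≤ℝ_

_<ℝ_ : ℝ → ℝ → Set
x <ℝ y = ∃[ q ] U x q × L y q

_≤ℝ_ : ℝ → ℝ → Set
x ≤ℝ y = ¬ (y <ℝ x)

private
  cancel⁺ : ∀ q → (q + 1ℚ) - 1ℚ ≡ q
  cancel⁺ q = trans (+-assoc q 1ℚ (- 1ℚ))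
                    (trans (cong (q +_) (+-inverseʳ 1ℚ)) (+-identityʳ q))

  cancel⁻ : ∀ q → (q - 1ℚ) + 1ℚ ≡ q
  cancel⁻ q = trans (+-assoc q (- 1ℚ) 1ℚ)
                    (trans (cong (q +_) (+-inverseˡ 1ℚ)) (+-identityʳ q))

-- Both halves of the cut are translated by 1: q < x + 1 iff q - 1 < x.
infix 8 _+1

_+1 : ℝ → ℝ
x +1 = record
  { L           = λ q → L x (q - 1ℚ)
  ; U           = λ q → U x (q - 1ℚ)
  ; L-inhabited = let (q , l) = L-inhabited x in
                  q + 1ℚ , subst (L x) (sym (cancel⁺ q)) l
  ; U-inhabited = let (q , u) = U-inhabited x in
                  q + 1ℚ , subst (U x) (sym (cancel⁺ q)) u
  ; L-rounded   = λ q → mk⇔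
      (λ l → let (r , q<r , lr) = Equivalence.to (L-rounded x (q - 1ℚ)) l in
             r + 1ℚ
             , subst (_< r + 1ℚ) (cancel⁻ q) (+-monoˡ-< 1ℚ q<r)
             , subst (L x) (sym (cancel⁺ r)) lr)
      (λ (r , q<r , lr) →
         Equivalence.from (L-rounded x (q - 1ℚ)) (r - 1ℚ , +-monoˡ-< (- 1ℚ) q<r , lr))
  ; U-rounded   = λ q → mk⇔
      (λ u → let (r , r<q , ur) = Equivalence.to (U-rounded x (q - 1ℚ)) u in
             r + 1ℚ
             , subst (r + 1ℚ <_) (cancel⁻ q) (+-monoˡ-< 1ℚ r<q)
             , subst (U x) (sym (cancel⁺ r)) ur)
      (λ (r , r<q , ur) →
         Equivalence.from (U-rounded x (q - 1ℚ)) (r - 1ℚ , +-monoˡ-< (- 1ℚ) r<q , ur))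
  ; disjoint    = λ q → disjoint x (q - 1ℚ)
  ; located     = λ q r q<r → located x (q - 1ℚ) (r - 1ℚ) (+-monoˡ-< (- 1ℚ) q<r)
  }

------------------------------------------------------------------------
-- Unit squares and visibility

-- The closed square [left , left + 1] × [bottom , bottom + 1].
record Square : Set₁ where
  constructor square
  field
    left bottom : ℝ

open Square public

-- Exchanges the roles of the two axes.
transpose : Square → Square
transpose S = square (bottom S) (left S)

Interior : Square → ℝ → ℝ → Set
Interior S x y = (left S <ℝ x × x <ℝ left S +1) × (bottom S <ℝ y × y <ℝ bottom S +1)

DisjointInteriors : Square → Square → Set₁
DisjointInteriors S T = ∀ x y → ¬ (Interior S x y × Interior T x y)

-- On a horizontal line meeting the interiors of both squares, the abscissae of
-- the closed segment (possibly a point) from the right side of one square to the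
-- left side of the other. When the interiors are disjoint, exactly one of the
-- two orders occurs and the other alternative is empty.
Between : Square → Square → ℝ → Set
Between S T x = (left S +1 ≤ℝ x × x ≤ℝ left T) ⊎ (left T +1 ≤ℝ x × x ≤ℝ left S)

-- The band's interval I is (a , b).
HorizontalBand : ∀ {n} → (Fin n → Square) → Fin n → Fin n → Set₁
HorizontalBand S v w =
  ∃[ a ] ∃[ b ] a <ℝ b ×
    (∀ y₀ → a <ℝ y₀ → y₀ <ℝ b →
      (∃[ x ] Interior (S v) x y₀) ×
      (∃[ x ] Interior (S w) x y₀) ×
      (∀ u → u ≢ v → u ≢ w → ∀ x → Between (S v) (S w) x → ¬ Interior (S u) x y₀))

VerticalBand : ∀ {n} → (Fin n → Square) → Fin n → Fin n → Set₁
VerticalBand S = HorizontalBand (transpose ∘ S)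

IsURVG : ∀ {n} → Graph n → Set₁
IsURVG {n} G =
  Σ[ S ∈ (Fin n → Square) ]
    (∀ v w → v ≢ w → DisjointInteriors (S v) (S w)) ×
    (∀ v w → v ≢ w → Adj G v w ⇔ (HorizontalBand S v w ⊎ VerticalBand S v w))

{-# OPTIONS --safe #-}

-- List the vertices of a linear forest path by path, and let consecutive
-- vertices of the list be 2/3 apart when they are adjacent and 1 apart otherwise.
-- The unit intervals starting at these points overlap exactly when the vertices
-- are adjacent, and no third interval meets an overlap; so squares with these
-- intervals as projections see each other exactly along the edges of the forest,
-- whatever their other coordinates are. Take the bottom sides from one forest
-- and the left sides from the other one, deprived of the edges of the first:
-- then no two squares overlap in both projections.
module Submission where

open import Defs
open import Data.Empty using (⊥-elim)
open import Data.Fin as Fin using (Fin; zero; suc; toℕ; combine; inject≤)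
import Data.Fin.Properties as Fin
open import Data.Nat as ℕ using (ℕ; zero; suc; _+_; _*_; z≤n; s≤s)
import Data.Nat.Properties as ℕ
open import Data.Product using (∃; ∃-syntax; _×_; _,_; proj₁; proj₂)
open import Data.Rational as ℚ using (ℚ; 0ℚ; 1ℚ; ½)
import Data.Rational.Properties as ℚ
import Data.Integer as ℤ
open import Data.Sum as Sum using (_⊎_; inj₁; inj₂)
open import Function using (_∘_; _⇔_; mk⇔; Equivalence)
open import Function.Definitions using (Injective)
open import Level using (0ℓ)
open import Relation.Binary using (Rel; Decidable; Symmetric; Tri; tri<; tri≈; tri>)
open import Relation.Binary.Construct.Closure.ReflexiveTransitive using (ε; _◅_; reverse)
open import Relation.Binary.PropositionalEquality
  using (_≡_; _≢_; refl; sym; trans; cong; subst; subst₂; module ≡-Reasoning)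
open import Relation.Nullary using (¬_; Dec; yes; no)
open import Relation.Nullary.Decidable using (map′; _×-dec_; ¬?)
import Relation.Unary as Unary

open ComponentIsPath

-- Ranking the vertices of a linear forest

least : ∀ {n} {P : Fin n → Set} → Unary.Decidable P → ∃ P →
        ∃[ i ] P i × (∀ j → P j → i Fin.≤ j)
least {suc n} P? (i , p) with P? zero
... | yes p₀ = zero , p₀ , λ _ _ → z≤n
least {suc n} P? (zero , p)  | no ¬p₀ = ⊥-elim (¬p₀ p)
least {suc n} P? (suc i , p) | no ¬p₀ with least (P? ∘ suc) (i , p)
... | j , q , min = suc j , q , λ where
  zero    p₀ → ⊥-elim (¬p₀ p₀)
  (suc l) r  → s≤s (min l r)

combine-suc : ∀ {m n} (c : Fin m) {i j : Fin n} → toℕ j ≡ suc (toℕ i) →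
              toℕ (combine c j) ≡ suc (toℕ (combine c i))
combine-suc {n = n} c {i} {j} next = begin
  toℕ (combine c j)         ≡⟨ Fin.toℕ-combine c j ⟩
  n * toℕ c + toℕ j         ≡⟨ cong (n * toℕ c +_) next ⟩
  n * toℕ c + suc (toℕ i)   ≡⟨ ℕ.+-suc _ _ ⟩
  suc (n * toℕ c + toℕ i)   ≡⟨ cong suc (Fin.toℕ-combine c i) ⟨
  suc (toℕ (combine c i))   ∎
  where open ≡-Reasoning

combine-consecutive : ∀ {m n} {c d : Fin m} {i j : Fin n} → c ≡ d → Consecutive i j →
                      Consecutive (combine c i) (combine d j)
combine-consecutive {c = c} refl = Sum.map (combine-suc c) (combine-suc c)

module _ {n} (F : Graph n) (path : ∀ v → ComponentIsPath F v) where

  private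
    -- Reachability is decided by searching the finite list of vertices of the path through `v`.
    connected? : Decidable (Connected F)
    connected? v w = map′ (Equivalence.from (range (path v) w)) (Equivalence.to (range (path v) w))
                          (Fin.any? λ i → vertex (path v) i Fin.≟ w)

    -- The vertices of a component may come with different parametrisations of it;
    -- all of them have to use the one attached to the same representative.
    leastConnected : ∀ v → ∃[ c ] Connected F v c × (∀ w → Connected F v w → c Fin.≤ w)
    leastConnected v = least (connected? v) (v , ε)

    root : Fin n → Fin n
    root = proj₁ ∘ leastConnected

    root-connected : ∀ v → Connected F (root v) v
    root-connected v = reverse (symm F) (proj₁ (proj₂ (leastConnected v)))

    root-adjacent : ∀ {v w} → Adj F v w → root v ≡ root w
    root-adjacent {v} {w} vw = Fin.≤-antisym (root-minimal vw) (root-minimal (symm F vw))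
      where
      root-minimal : ∀ {v w} → Adj F v w → root v Fin.≤ root w
      root-minimal {v} {w} vw =
        proj₂ (proj₂ (leastConnected v)) (root w) (vw ◅ proj₁ (proj₂ (leastConnected w)))

    index : ∀ {c v} → Connected F c v → Fin (k (path c))
    index {c} {v} cv = proj₁ (Equivalence.to (range (path c) v) cv)

    vertex-index : ∀ {c v} (cv : Connected F c v) → vertex (path c) (index cv) ≡ v
    vertex-index {c} {v} cv = proj₂ (Equivalence.to (range (path c) v) cv)

    length≤n : ∀ c → k (path c) ℕ.≤ n
    length≤n c = Fin.injective⇒≤ (injective (path c))

    -- Positions on paths of various lengths go into one common width `n`, so that `combine` can
    -- order pairs of a root and a position lexicographically.
    slot : ∀ {c v} → Connected F c v → Fin n
    slot {c} cv = inject≤ (index cv) (length≤n c)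

    -- Equality of the representatives is a separate argument between variables: matching it with
    -- `refl` puts both positions on the same path.
    slot-injective : ∀ {c d v w} → c ≡ d → (cv : Connected F c v) (dw : Connected F d w) →
                     slot cv ≡ slot dw → v ≡ w
    slot-injective {c} refl cv cw eq =
      trans (sym (vertex-index cv))
        (trans (cong (vertex (path c)) (Fin.inject≤-injective _ _ _ _ eq)) (vertex-index cw))

    slot-consecutive : ∀ {c d v w} → c ≡ d → (cv : Connected F c v) (dw : Connected F d w) →
                       Adj F v w → Consecutive (slot cv) (slot dw)
    slot-consecutive {c} refl cv cw vw
      rewrite Fin.toℕ-inject≤ (index cv) (length≤n c) | Fin.toℕ-inject≤ (index cw) (length≤n c) =
      Equivalence.from (adjacent (path c) (index cv) (index cw))
        (subst₂ (Adj F) (sym (vertex-index cv)) (sym (vertex-index cw)) vw)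

  rank : Fin n → ℕ
  rank v = toℕ (combine (root v) (slot (root-connected v)))

  rank-injective : Injective _≡_ _≡_ rank
  rank-injective {v} {w} eq
    with roots , slots ← Fin.combine-injective (root v) _ (root w) _ (Fin.toℕ-injective eq) =
    slot-injective roots (root-connected v) (root-connected w) slots

  rank-consecutive : ∀ {v w} → Adj F v w → rank w ≡ suc (rank v) ⊎ rank v ≡ suc (rank w)
  rank-consecutive {v} {w} vw = combine-consecutive (root-adjacent vw)
    (slot-consecutive (root-adjacent vw) (root-connected v) (root-connected w) vw)

-- Positions in thirds of a unit

-- A unit has length 3, so the intervals starting at `p v` and `p w` meet in the one from `p w` to
-- `3 + p v`. By `alone`, every other interval ends before this overlap or begins after it.
record Overlapping {n} (p : Fin n → ℕ) (v w : Fin n) : Set where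
  constructor overlapping
  field
    ordered : p v ℕ.≤ p w
    close   : p w ℕ.< 3 + p v
    alone   : ∀ u → u ≢ v → u ≢ w → 3 + p u ℕ.≤ p w ⊎ 3 + p v ℕ.≤ p u

-- Any overlap must come from `H`, which serves both bands and disjointness of squares; pairs in `H`
-- get an overlap free of third intervals.
record Realises {n} (p : Fin n → ℕ) (H : Rel (Fin n) 0ℓ) : Set where
  field
    sound    : ∀ {v w} → v ≢ w → p v ℕ.< 3 + p w → p w ℕ.< 3 + p v → H v w
    complete : ∀ {v w} → H v w → Overlapping p v w ⊎ Overlapping p w v

open Realises

module _ {n} {H : Rel (Fin n) 0ℓ} (H? : Decidable H) (H-sym : Symmetric H)
         (r : Fin n → ℕ) (r-injective : Injective _≡_ _≡_ r)
         (r-consecutive : ∀ {v w} → H v w → r w ≡ suc (r v) ⊎ r v ≡ suc (r w)) where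

  private
    -- Phrased for numbers, since ranks may skip values; next to a skipped value the gap is 3.
    Joined : ℕ → Set
    Joined i = ∃[ v ] ∃[ w ] r v ≡ i × r w ≡ suc i × H v w

    joined? : ∀ i → Dec (Joined i)
    joined? i = Fin.any? λ v → Fin.any? λ w → (r v ℕ.≟ i) ×-dec (r w ℕ.≟ suc i) ×-dec H? v w

    gap : ∀ {i} → Dec (Joined i) → ℕ
    gap (yes _) = 2
    gap (no _)  = 3

    2≤gap : ∀ {i} (d : Dec (Joined i)) → 2 ℕ.≤ gap d
    2≤gap (yes _) = ℕ.≤-refl
    2≤gap (no _)  = ℕ.n≤1+n 2

    place : ℕ → ℕ
    place zero    = 0
    place (suc i) = gap (joined? i) + place i

    place-step : ∀ i → 2 + place i ℕ.≤ place (suc i)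
    place-step i = ℕ.+-monoˡ-≤ (place i) (2≤gap (joined? i))

    place-< : ∀ {i j} → i ℕ.< j → 2 + place i ℕ.≤ place j
    place-< i<j = go (ℕ.≤⇒≤′ i<j)
      where
      go : ∀ {i j} → suc i ℕ.≤′ j → 2 + place i ℕ.≤ place j
      go {i} (ℕ.≤′-reflexive refl) = place-step i
      go {i} {suc j} (ℕ.≤′-step i<j) =
        ℕ.≤-trans (go i<j) (ℕ.≤-trans (ℕ.m≤n+m _ 2) (place-step j))

    place-joined : ∀ {i} → Joined i → place (suc i) ≡ 2 + place i
    place-joined {i} p with joined? i
    ... | yes _ = refl
    ... | no ¬p = ⊥-elim (¬p p)

    close⇒joined : ∀ {i} → place (suc i) ℕ.< 3 + place i → Joined i
    close⇒joined {i} lt with joined? i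
    ... | yes p = p
    ... | no _  = ⊥-elim (ℕ.<-irrefl refl lt)

    close⇒H : ∀ {v w} → r v ℕ.< r w → place (r w) ℕ.< 3 + place (r v) → H v w
    close⇒H {v} {w} rv<rw lt with ℕ.m≤n⇒m<n∨m≡n rv<rw
    -- Ranks differing by two or more give a distance of at least 2 + 2, beyond the unit length 3.
    ... | inj₁ far = ⊥-elim (ℕ.<⇒≱ lt
            (ℕ.≤-trans (ℕ.n≤1+n _)
              (ℕ.≤-trans (ℕ.+-monoʳ-≤ 2 (place-step (r v))) (place-< far))))
    ... | inj₂ next with close⇒joined (subst (λ i → place i ℕ.< 3 + place (r v)) (sym next) lt)
    -- The joined vertices found have the ranks of `v` and `w`, hence are `v` and `w`.
    ... | v′ , w′ , eqv , eqw , h =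
            subst₂ H (r-injective eqv) (r-injective (trans eqw next)) h

    H⇒overlapping : ∀ {v w} → r w ≡ suc (r v) → H v w → Overlapping (place ∘ r) v w
    H⇒overlapping {v} {w} next h = overlapping
      (subst (place (r v) ℕ.≤_) (sym step) (ℕ.m≤n+m _ 2))
      (subst (ℕ._< 3 + place (r v)) (sym step) ℕ.≤-refl)
      alone
      where
      step : place (r w) ≡ 2 + place (r v)
      step = trans (cong place next) (place-joined (v , w , refl , next , h))

      alone : ∀ u → u ≢ v → u ≢ w → 3 + place (r u) ℕ.≤ place (r w) ⊎ 3 + place (r v) ℕ.≤ place (r u)
      -- Either `u` starts at least 2 before `v`, thus 4 before `w`, or at least 2 after `w`, thus 4
      -- after `v`.
      alone u u≢v u≢w with ℕ.<-cmp (r u) (r v)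
      ... | tri< u<v _ _ = inj₁ (subst (3 + place (r u) ℕ.≤_) (sym step)
                             (s≤s (ℕ.≤-trans (place-< u<v) (ℕ.n≤1+n _))))
      ... | tri≈ _ u≡v _ = ⊥-elim (u≢v (r-injective u≡v))
      ... | tri> _ _ v<u = inj₂ (ℕ.≤-trans (ℕ.n≤1+n _)
                             (subst (λ m → 2 + m ℕ.≤ _) step (place-< w<u)))
        where
        w<u : r w ℕ.< r u
        w<u = ℕ.≤∧≢⇒< (subst (ℕ._≤ r u) (sym next) v<u) (u≢w ∘ sym ∘ r-injective)

  -- The condition on ranks passes to subrelations, so the ranking of a forest still serves after
  -- some of its edges are removed.
  realisable : ∃[ p ] Realises p H
  realisable = place ∘ r , record
    { sound = λ {v} {w} v≢w pv<pw+3 pw<pv+3 → case-< v≢w pv<pw+3 pw<pv+3 (ℕ.<-cmp (r v) (r w))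
    ; complete = λ h → Sum.map (λ next → H⇒overlapping next h)
                               (λ next → H⇒overlapping next (H-sym h)) (r-consecutive h)
    }
    where
    case-< : ∀ {v w} → v ≢ w → place (r v) ℕ.< 3 + place (r w) → place (r w) ℕ.< 3 + place (r v) →
             Tri (r v ℕ.< r w) (r v ≡ r w) (r w ℕ.< r v) → H v w
    case-< v≢w _  lt (tri< v<w _ _) = close⇒H v<w lt
    case-< v≢w _  _  (tri≈ _ eq _)  = ⊥-elim (v≢w (r-injective eq))
    case-< v≢w lt _  (tri> _ _ w<v) = H-sym (close⇒H w<v lt)

-- Rational points of the real line

⅓ : ℚ
⅓ = ℤ.+ 1 ℚ./ 3

thirds : ℕ → ℚ
thirds zero    = 0ℚ
thirds (suc m) = thirds m ℚ.+ ⅓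

p<p+q : ∀ p q → .{{ℚ.Positive q}} → p ℚ.< p ℚ.+ q
p<p+q p q = subst (ℚ._< p ℚ.+ q) (ℚ.+-identityʳ p) (ℚ.+-monoʳ-< p (ℚ.positive⁻¹ q))

thirds-mono-≤ : ∀ {m l} → m ℕ.≤ l → thirds m ℚ.≤ thirds l
thirds-mono-≤ m≤l = go (ℕ.≤⇒≤′ m≤l)
  where
  go : ∀ {m l} → m ℕ.≤′ l → thirds m ℚ.≤ thirds l
  go (ℕ.≤′-reflexive refl) = ℚ.≤-refl
  go {l = suc l} (ℕ.≤′-step m≤l) = ℚ.≤-trans (go m≤l) (ℚ.<⇒≤ (p<p+q (thirds l) ⅓))

thirds-mono-< : ∀ {m l} → m ℕ.< l → thirds m ℚ.< thirds l
thirds-mono-< {m} m<l = ℚ.<-≤-trans (p<p+q (thirds m) ⅓) (thirds-mono-≤ m<l)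

thirds-cancel-< : ∀ {m l} → thirds m ℚ.< thirds l → m ℕ.< l
thirds-cancel-< lt = ℕ.≰⇒> λ l≤m → ℚ.<-irrefl refl (ℚ.<-≤-trans lt (thirds-mono-≤ l≤m))

thirds-3+ : ∀ m → thirds (3 + m) ≡ thirds m ℚ.+ 1ℚ
-- Once reassociated, the closed sum of three `⅓` evaluates to `1ℚ`.
thirds-3+ m = trans (cong (ℚ._+ ⅓) (ℚ.+-assoc (thirds m) ⅓ ⅓)) (ℚ.+-assoc (thirds m) (⅓ ℚ.+ ⅓) ⅓)

p-1<q⇒p<q+1 : ∀ {p q} → p ℚ.- 1ℚ ℚ.< q → p ℚ.< q ℚ.+ 1ℚ
p-1<q⇒p<q+1 {p} {q} lt = subst (ℚ._< q ℚ.+ 1ℚ) eq (ℚ.+-monoˡ-< 1ℚ lt)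
  where
  eq : p ℚ.- 1ℚ ℚ.+ 1ℚ ≡ p
  eq = trans (ℚ.+-assoc p _ _) (ℚ.+-identityʳ p)

p<q+1⇒p-1<q : ∀ {p q} → p ℚ.< q ℚ.+ 1ℚ → p ℚ.- 1ℚ ℚ.< q
p<q+1⇒p-1<q {p} {q} lt = subst (p ℚ.- 1ℚ ℚ.<_) eq (ℚ.+-monoˡ-< (ℚ.- 1ℚ) lt)
  where
  eq : q ℚ.+ 1ℚ ℚ.- 1ℚ ≡ q
  eq = trans (ℚ.+-assoc q _ _) (ℚ.+-identityʳ q)

fromℚ : ℚ → ℝ
fromℚ p = record
  { L           = ℚ._< p
  ; U           = p ℚ.<_
  ; L-inhabited = p ℚ.- 1ℚ , p<q+1⇒p-1<q (p<p+q p 1ℚ)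
  ; U-inhabited = p ℚ.+ 1ℚ , p<p+q p 1ℚ
  ; L-rounded   = λ q → mk⇔ ℚ.<-dense (λ (r , q<r , r<p) → ℚ.<-trans q<r r<p)
  ; U-rounded   = λ q → mk⇔ (λ p<q → let (r , p<r , r<q) = ℚ.<-dense p<q in r , r<q , p<r)
                            (λ (r , r<q , p<r) → ℚ.<-trans p<r r<q)
  ; disjoint    = λ q (q<p , p<q) → ℚ.<-asym q<p p<q
  ; located     = λ q r → compare
  }
  where
  compare : ∀ {q r} → q ℚ.< r → q ℚ.< p ⊎ p ℚ.< r
  compare {q} q<r with q ℚ.<? p
  ... | yes q<p = inj₁ q<p
  ... | no q≮p  = inj₂ (ℚ.≤-<-trans (ℚ.≮⇒≥ q≮p) q<r)

-- If `q` were at most `p`, roundedness would bring `q` into the lower cut as well, against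
-- `disjoint`.
L<U : ∀ x {p q} → L x p → U x q → p ℚ.< q
L<U x {p} {q} lp uq with p ℚ.<? q
... | yes p<q = p<q
... | no p≮q with ℚ.<-cmp q p
... | tri< q<p _ _ = ⊥-elim (disjoint x q (Equivalence.from (L-rounded x q) (p , q<p , lp) , uq))
... | tri≈ _ refl _ = ⊥-elim (disjoint x q (lp , uq))
... | tri> _ _ p<q = p<q

<ℝ-fromℚ : ∀ x {q} → U x q → x <ℝ fromℚ q
<ℝ-fromℚ x {q} uq = let (r , r<q , ur) = Equivalence.to (U-rounded x q) uq in r , ur , r<q

fromℚ-<ℝ : ∀ x {q} → L x q → fromℚ q <ℝ x
fromℚ-<ℝ x {q} lq = Equivalence.to (L-rounded x q) lq

coordinate : ℕ → ℝ
coordinate m = fromℚ (thirds m)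

-- The rational witnesses on both sides of `x` give `thirds m` below `thirds l + 1`, and
-- monotonicity of `thirds` brings this back to natural numbers.
coordinate-close : ∀ {m l} x → coordinate m <ℝ x → x <ℝ coordinate l +1 → m ℕ.< 3 + l
coordinate-close {m} {l} x (q , m<q , lq) (q′ , uq′ , q′-1<l) = thirds-cancel-<
  (subst (thirds m ℚ.<_) (sym (thirds-3+ l))
    (ℚ.<-trans m<q (ℚ.<-trans (L<U x lq uq′) (p-1<q⇒p<q+1 q′-1<l))))

coordinate-monoˡ : ∀ {m l} x → m ℕ.≤ l → coordinate l <ℝ x → coordinate m <ℝ x
coordinate-monoˡ x m≤l (q , l<q , lq) = q , ℚ.≤-<-trans (thirds-mono-≤ m≤l) l<q , lq

coordinate-monoʳ : ∀ {m l} x → m ℕ.≤ l → x <ℝ coordinate m +1 → x <ℝ coordinate l +1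
coordinate-monoʳ x m≤l (q , uq , q-1<m) = q , uq , ℚ.<-≤-trans q-1<m (thirds-mono-≤ m≤l)

coordinate-< : ∀ {m l} → l ℕ.< 3 + m → coordinate l <ℝ coordinate m +1
coordinate-< {m} {l} l<3+m = fromℚ-<ℝ (coordinate m +1)
  (p<q+1⇒p-1<q (subst (thirds l ℚ.<_) (thirds-3+ m) (thirds-mono-< l<3+m)))

unit-inhabited : ∀ m → ∃[ x ] coordinate m <ℝ x × x <ℝ coordinate m +1
unit-inhabited m = fromℚ (thirds m ℚ.+ ½)
  , <ℝ-fromℚ (coordinate m) (p<p+q (thirds m) ½)
  , fromℚ-<ℝ (coordinate m +1) (p<q+1⇒p-1<q (ℚ.+-monoʳ-< (thirds m) (ℚ.*<* (ℤ.+<+ ℕ.≤-refl))))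

-- Visibility

HorizontalBand-sym : ∀ {n} {S : Fin n → Square} {v w} → HorizontalBand S v w → HorizontalBand S w v
HorizontalBand-sym (a , b , a<b , band) = a , b , a<b , λ y a<y y<b →
  let (inv , inw , clear) = band y a<y y<b in
  inw , inv , λ u u≢w u≢v x → clear u u≢v u≢w x ∘ Sum.swap

module _ {n} (p q : Fin n → ℕ) where

  squares : Fin n → Square
  squares v = square (coordinate (p v)) (coordinate (q v))

  overlapping⇒band : ∀ {v w} → Overlapping q v w → HorizontalBand squares v w
  overlapping⇒band {v} {w} (overlapping ordered close alone) =
    -- The band fills the whole overlap, from the bottom of `w` to the top of `v`.
    coordinate (q w) , coordinate (q v) +1 , coordinate-< close , λ y w<y y<v+1 →
      let (x  , xv) = unit-inhabited (p v)
          (x′ , xw) = unit-inhabited (p w)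
      in (x , xv , coordinate-monoˡ y ordered w<y , y<v+1)
       , (x′ , xw , w<y , coordinate-monoʳ y ordered y<v+1)
       , λ u u≢v u≢w _ _ (_ , u<y , y<u+1) → Sum.[
             (λ u+3≤w → ℕ.<⇒≱ (coordinate-close y w<y y<u+1) u+3≤w)
           , (λ v+3≤u → ℕ.<⇒≱ (coordinate-close y u<y y<v+1) v+3≤u)
           ] (alone u u≢v u≢w)

  band⇒close : ∀ {v w} → HorizontalBand squares v w → q v ℕ.< 3 + q w × q w ℕ.< 3 + q v
  -- One line suffices: the rational separating `a` from `b` gives a height inside both squares.
  band⇒close (a , b , (y , ay , by) , band)
    with (_ , _ , v<y , y<v+1) , (_ , _ , w<y , y<w+1) , _
           ← band (fromℚ y) (<ℝ-fromℚ a ay) (fromℚ-<ℝ b by) =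
    coordinate-close (fromℚ y) v<y y<w+1 , coordinate-close (fromℚ y) w<y y<v+1

  module _ {H : Rel (Fin n) 0ℓ} (R : Realises q H) where

    adjacent⇒band : ∀ {v w} → H v w → HorizontalBand squares v w
    adjacent⇒band vw =
      Sum.[ overlapping⇒band , HorizontalBand-sym {S = squares} ∘ overlapping⇒band ] (complete R vw)

    band⇒adjacent : ∀ {v w} → v ≢ w → HorizontalBand squares v w → H v w
    band⇒adjacent v≢w band = let (v<w+3 , w<v+3) = band⇒close band in sound R v≢w v<w+3 w<v+3

-- Combining two disjoint relations

squares-disjoint : ∀ {n} {p q : Fin n → ℕ} {H K : Rel (Fin n) 0ℓ} → Realises p H → Realises q K →
                   (∀ {v w} → H v w → ¬ K v w) →
                   ∀ v w → v ≢ w → DisjointInteriors (squares p q v) (squares p q w)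
squares-disjoint P Q H∩K≡∅ v w v≢w x y
  (((vˡ , vʳ) , (vᵇ , vᵗ)) , ((wˡ , wʳ) , (wᵇ , wᵗ))) =
  -- A common interior point makes both projections overlap, which puts the pair in `H` and in `K`.
  H∩K≡∅ (sound P v≢w (coordinate-close x vˡ wʳ) (coordinate-close x wˡ vʳ))
        (sound Q v≢w (coordinate-close y vᵇ wᵗ) (coordinate-close y wᵇ vᵗ))

realised-union⇒URVG : ∀ {n} (G : Graph n) {p q : Fin n → ℕ} {H K : Rel (Fin n) 0ℓ} →
                      Realises p H → Realises q K → (∀ {v w} → H v w → ¬ K v w) →
                      (∀ v w → Adj G v w ⇔ (K v w ⊎ H v w)) → IsURVG G
realised-union⇒URVG G {p} {q} P Q H∩K≡∅ union =
  squares p q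
  , squares-disjoint P Q H∩K≡∅
  , λ v w v≢w → mk⇔
      -- Transposing `squares p q` yields `squares q p` by computation, so vertical bands are
      -- horizontal ones with `p` and `q` exchanged.
      (Sum.map (adjacent⇒band p q Q) (adjacent⇒band q p P) ∘ Equivalence.to (union v w))
      (Equivalence.from (union v w) ∘ Sum.map (band⇒adjacent p q Q v≢w) (band⇒adjacent q p P v≢w))

theorem4p6 : ∀ (n : ℕ) (G : Graph n) → HasLinearArboricity G 2 → IsURVG G
theorem4p6 n G ((F , linear , union) , _) =
  realised-union⇒URVG G (proj₂ realisation-of-B∖A) (proj₂ realisation-of-A) proj₂
    (λ v w → mk⇔ (split ∘ Equivalence.to (union v w)) (Equivalence.from (union v w) ∘ merge))
  where
  path : ∀ i v → ComponentIsPath (F i) v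
  path i = proj₂ (linear i)

  A B B∖A : Rel (Fin n) 0ℓ
  A = Adj (F zero)
  B = Adj (F (suc zero))
  B∖A v w = B v w × ¬ A v w

  realisation-of-A : ∃[ q ] Realises q A
  realisation-of-A = realisable (adj? (F zero)) (symm (F zero))
    (rank _ (path zero)) (rank-injective _ (path zero)) (rank-consecutive _ (path zero))

  realisation-of-B∖A : ∃[ p ] Realises p B∖A
  realisation-of-B∖A = realisable
    (λ v w → adj? (F (suc zero)) v w ×-dec ¬? (adj? (F zero) v w))
    (λ (b , ¬a) → symm (F (suc zero)) b , ¬a ∘ symm (F zero))
    (rank _ (path (suc zero))) (rank-injective _ (path (suc zero)))
    (rank-consecutive _ (path (suc zero)) ∘ proj₁)

  split : ∀ {v w} → ∃[ i ] Adj (F i) v w → A v w ⊎ B∖A v w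
  split (zero , a) = inj₁ a
  -- An edge shared by both forests is credited to `A` alone.
  split {v} {w} (suc zero , b) with adj? (F zero) v w
  ... | yes a = inj₁ a
  ... | no ¬a = inj₂ (b , ¬a)

  merge : ∀ {v w} → A v w ⊎ B∖A v w → ∃[ i ] Adj (F i) v w
  merge = Sum.[ zero ,_ , (λ (b , _) → suc zero , b) ]
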